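{- Let $\mathsf{S}$ be a minors system. Then the Grothendieck monoid $U(\mathsf{S})$ is the commutative monoid generated by the classes $[X]$ for $X\in\mathsf{S}_1$ (isomorphism classes of structures on a one-element set), subject to the relations: (1) $[X|e]\,[X/e]=[X|f]\,[X/f]$ for every two-element set $\{e,f\}$ and every $X\in\mathsf{S}[\{e,f\}]$; (2) $[X\oplus Y]=[X]$ for every $X\in\mathsf{S}_1$ and $Y\in\mathsf{S}_0$. That is, the natural morphism from the commutative monoid given by this presentation to $U(\mathsf{S})$, sending the generator $[X]$ to $[X]$, is an isomorphism.
   Context: A set species $\mathsf{S}$ is a functor from the category of finite sets and bijections to the category of sets; $\mathsf{S}_n=\mathsf{S}[\{1,\dots,n\}]/\Sigma_n$ denotes the set of isomorphism classes of structures on $n$-element sets, and $\mathsf{S}_\bullet=\bigsqcup_{n\ge 0}\mathsf{S}_n$. The same symbol is used for $X\in \mathsf{S}[E]$ and its isomorphism class. A minors system is a set species $\mathsf{S}$ with, for every finite set $E$ and $A\subseteq E$, maps $\mathsf{S}[E]\to\mathsf{S}[A]$, $X\mapsto X|A$ (restriction) and $\mathsf{S}[E]\to \mathsf{S}[E\setminus A]$, $X\mapsto X/A$ (contraction), and maps $\mathsf{S}[E]\times\mathsf{S}[\varnothing]\to\mathsf{S}[E]$, $(X,Y)\mapsto X\oplus Y$ (direct sum), such that: restriction, contraction and $\oplus$ are compatible with bijections of ground sets; for disjoint $A,B\subseteq E$ and $X\in\mathsf{S}[E]$: $(X|A\sqcup B)|A=X|A$, $(X/A)|B=(X|A\sqcup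 B)/A$, $(X/A)/B=X/(A\sqcup B)$; $X|E=X$ and $X/\varnothing=X$ for $X\in\mathsf{S}[E]$; $X\oplus(Y\oplus Z)=(X\oplus Y)\oplus Z$ for $X\in\mathsf{S}[E]$, $Y,Z\in\mathsf{S}[\varnothing]$; $X\oplus Y=Y\oplus X$ for $X,Y\in\mathsf{S}[\varnothing]$; there is $1_{\mathsf{S}}\in\mathsf{S}[\varnothing]$ with $X\oplus 1_{\mathsf{S}}=X$ for all $X\in \mathsf{S}[E]$; $(X\oplus Y)|A=(X|A)\oplus Y$ and $(X\oplus Y)/A=(X/A)\oplus Y$ for $X\in\mathsf{S}[E]$, $Y\in\mathsf{S}[\varnothing]$, $A\subseteq E$. The Grothendieck monoid $U(\mathsf{S})$ is the commutative monoid (written multiplicatively) with generators $[X]$ for all $X\in\mathsf{S}_\bullet$ and relations: $[X]=[X|A][X/A]$ for every $X\in\mathsf{S}[E]$ and $A\subseteq E$; $[X\oplus Y]=[X]$ for every $X\in\mathsf{S}[E]$, $Y\in\mathsf{S}[\varnothing]$; $[1_{\mathsf{S}}]=1$. For an element $e$, $X|e$ and $X/e$ mean $X|\{e\}$ and $X/\{e\}$. -}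

module Defs where

open import Algebra.Bundles using (CommutativeMonoid)
open import Data.Bool.Base using (Bool; true; false; not; _∨_; T)
open import Data.Bool.Properties using (T-irrelevant)
open import Data.Empty using (⊥; ⊥-elim)
open import Data.Fin.Base using (Fin; zero; suc)
import Data.Fin.Properties as Fin
open import Data.Nat.Base using (ℕ; zero; suc; _+_)
open import Data.Product.Base using (Σ; ∃; _×_; _,_; proj₁; proj₂)
open import Data.Sum.Base using (_⊎_; inj₁; inj₂; swap)
open import Data.Sum.Function.Propositional using (_⊎-↔_)
open import Data.Unit.Base using (tt)
open import Function.Base using (_∘_)
open import Function.Bundles using (_↔_; mk↔ₛ′; Inverse; _⇔_; mk⇔; Equivalence)
open import Function.Construct.Composition using (_↔-∘_)
open import Function.Construct.Identity using (↔-id)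
open import Function.Construct.Symmetry using (↔-sym)
open import Function.Properties.Inverse using (↔⇒↣)
open import Level using (Level; 0ℓ; _⊔_) renaming (suc to lsuc)
open import Relation.Binary.Bundles using (Setoid)
open import Relation.Binary.Core using (Rel)
open import Relation.Binary.Definitions using (DecidableEquality)
open import Relation.Binary.PropositionalEquality
  using (_≡_; _≢_; _≗_; refl; sym; trans; cong; subst)
open import Relation.Nullary.Decidable
  using (⌊_⌋; via-injection; toWitness; fromWitness; toWitnessFalse; fromWitnessFalse)

open Inverse using (to; from; strictlyInverseˡ; strictlyInverseʳ)

-- The enumeration only witnesses finiteness: morphisms are all bijections of
-- the underlying sets, so two enumerations of one set give isomorphic objects.

record FinSet : Set₁ where
  field
    El   : Set
    size : ℕ
    enum : El ↔ Fin size

open FinSet public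

⟨_⟩ : ℕ → FinSet
⟨ n ⟩ = record { El = Fin n ; size = n ; enum = ↔-id (Fin n) }

∅ : FinSet
∅ = ⟨ 0 ⟩

-- Every subset of a finite set is (classically) decidable.

Subset : FinSet → Set
Subset E = El E → Bool

full : ∀ E → Subset E
full E _ = true

none : ∀ E → Subset E
none E _ = false

∁ : ∀ {A : Set} → (A → Bool) → (A → Bool)
∁ A e = not (A e)

infixr 6 _∪_

_∪_ : ∀ {A : Set} → (A → Bool) → (A → Bool) → (A → Bool)
(A ∪ B) e = A e ∨ B e

Disjoint : ∀ E → Subset E → Subset E → Set
Disjoint E A B = ∀ e → T (A e) → T (B e) → ⊥

decEq : ∀ E → DecidableEquality (El E)
decEq E = via-injection (↔⇒↣ (enum E)) Fin._≟_

⁅_∋_⁆ : ∀ E → El E → Subset E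
⁅ E ∋ e ⁆ x = ⌊ decEq E e x ⌋

subset≡ : ∀ {E : Set} (A : E → Bool) {x y : E} {p : T (A x)} {q : T (A y)} →
          x ≡ y → _≡_ {A = Σ E (T ∘ A)} (x , p) (y , q)
subset≡ A refl = cong (_ ,_) (T-irrelevant _ _)

-- A ≗ B ∘ to σ says that B is the image of A under σ.  Taking σ the identity,
-- this also identifies the subsets given by pointwise equal A and B.

restrict↔ : ∀ {E F : Set} {A : E → Bool} {B : F → Bool} (σ : E ↔ F) →
            A ≗ B ∘ to σ → Σ E (T ∘ A) ↔ Σ F (T ∘ B)
restrict↔ {E} {F} {A} {B} σ A≗Bσ = mk↔ₛ′
  (λ (e , a) → to σ e , subst T (A≗Bσ e) a)
  (λ (f , b) → from σ f ,
     subst T (trans (cong B (sym (strictlyInverseˡ σ f))) (sym (A≗Bσ (from σ f)))) b)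
  (λ (f , _) → subset≡ B (strictlyInverseˡ σ f))
  (λ (e , _) → subset≡ A (strictlyInverseʳ σ e))

subset-enum : ∀ {n} (A : Fin n → Bool) → ∃ λ k → Σ (Fin n) (T ∘ A) ↔ Fin k
subset-enum {zero}  A = 0 , mk↔ₛ′ (λ ()) (λ ()) (λ ()) (λ ())
subset-enum {suc n} A with subset-enum (A ∘ suc)
... | k , σ = bit (A zero) + k ,
  (↔-sym Fin.+↔⊎ ↔-∘ ((T↔bit (A zero) ⊎-↔ σ) ↔-∘ split))
  where
  bit : Bool → ℕ
  bit true  = 1
  bit false = 0

  T↔bit : ∀ b → T b ↔ Fin (bit b)
  T↔bit true  = ↔-sym Fin.1↔⊤
  T↔bit false = ↔-sym Fin.0↔⊥

  split : Σ (Fin (suc n)) (T ∘ A) ↔ (T (A zero) ⊎ Σ (Fin n) (T ∘ A ∘ suc))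
  split = mk↔ₛ′
    (λ { (zero , a) → inj₁ a ; (suc i , a) → inj₂ (i , a) })
    (λ { (inj₁ a) → zero , a ; (inj₂ (i , a)) → suc i , a })
    (λ { (inj₁ _) → refl ; (inj₂ _) → refl })
    (λ { (zero , _) → refl ; (suc _ , _) → refl })

sub : ∀ E → Subset E → FinSet
sub E A = record
  { El   = Σ (El E) (T ∘ A)
  ; size = proj₁ A-enum
  ; enum = proj₂ A-enum ↔-∘ restrict↔ (enum E) (λ e → cong A (sym (strictlyInverseʳ (enum E) e)))
  }
  where
  A-enum = subset-enum (A ∘ from (enum E))

-- B ↾ C is B ∩ C as a subset of C.

_↾_ : ∀ {E : Set} → (E → Bool) → (C : E → Bool) → Σ E (T ∘ C) → Bool
(B ↾ C) (e , _) = B e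

-- A subset of a subset of E is identified with a subset of E; these are the
-- canonical bijections, which all commute with the inclusions into E.

nested↔ : ∀ {E : Set} (C D F : E → Bool) → (∀ e → (T (C e) × T (D e)) ⇔ T (F e)) →
          Σ (Σ E (T ∘ C)) (T ∘ D ∘ proj₁) ↔ Σ E (T ∘ F)
nested↔ C D F C∩D⇔F = mk↔ₛ′
  (λ ((e , c) , d) → e , Equivalence.to (C∩D⇔F e) (c , d))
  (λ (e , f) → let (c , d) = Equivalence.from (C∩D⇔F e) f in (e , c) , d)
  (λ (e , _) → cong (e ,_) (T-irrelevant _ _))
  (λ ((e , _) , _) → cong (λ (c , d) → (e , c) , d) (T×T-irrelevant e))
  where
  T×T-irrelevant : ∀ e {p q : T (C e) × T (D e)} → p ≡ q
  T×T-irrelevant e {c , d} {c′ , d′} with T-irrelevant c c′ | T-irrelevant d d′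
  ... | refl | refl = refl

full↔ : ∀ {E : Set} → Σ E (λ _ → T true) ↔ E
full↔ = mk↔ₛ′ proj₁ (_, tt) (λ _ → refl) (λ _ → refl)

module _ (E : FinSet) (A B : Subset E) where

  restrict-restrict↔ : El (sub (sub E (A ∪ B)) (A ↾ (A ∪ B))) ↔ El (sub E A)
  restrict-restrict↔ = nested↔ (A ∪ B) A A (λ e → mk⇔ proj₂ (λ a → left (A e) a , a))
    where
    left : ∀ x {y} → T x → T (x ∨ y)
    left true _ = tt

  contract-restrict↔ : Disjoint E A B → El (sub (sub E (∁ A)) (B ↾ ∁ A)) ↔ El (sub E B)
  contract-restrict↔ A#B = nested↔ (∁ A) B B (λ e → mk⇔ proj₂ (λ b → avoid (A e) (A#B e) b , b))
    where
    avoid : ∀ x {y} → (T x → T y → ⊥) → T y → T (not x)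
    avoid true  x#y b = x#y tt b
    avoid false _   _ = tt

  restrict-contract↔ : Disjoint E A B → El (sub (sub E (A ∪ B)) (∁ (A ↾ (A ∪ B)))) ↔ El (sub E B)
  restrict-contract↔ A#B = nested↔ (A ∪ B) (∁ A) B
    (λ e → mk⇔ (λ (ab , ¬a) → diff (A e) ab ¬a) (avoid (A e) (A#B e)))
    where
    diff : ∀ x {y} → T (x ∨ y) → T (not x) → T y
    diff false b _ = b

    avoid : ∀ x {y} → (T x → T y → ⊥) → T y → T (x ∨ y) × T (not x)
    avoid true  x#y b = ⊥-elim (x#y tt b)
    avoid false _   b = b , tt

  contract-contract↔ : El (sub (sub E (∁ A)) (∁ (B ↾ ∁ A))) ↔ El (sub E (∁ (A ∪ B)))
  contract-contract↔ = nested↔ (∁ A) (∁ B) (∁ (A ∪ B))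
    (λ e → mk⇔ (λ (¬a , ¬b) → join (A e) ¬a ¬b) (split (A e)))
    where
    join : ∀ x {y} → T (not x) → T (not y) → T (not (x ∨ y))
    join false _ ¬b = ¬b

    split : ∀ x {y} → T (not (x ∨ y)) → T (not x) × T (not y)
    split false ¬b = tt , ¬b

-- The values of a species are setoids rather than bare types: without quotient
-- types, this is how a set given up to an equivalence is expressed.

record Species (c ℓ : Level) : Set (lsuc (0ℓ ⊔ c ⊔ ℓ)) where
  field
    S[_] : FinSet → Setoid c ℓ

  Str : FinSet → Set c
  Str E = Setoid.Carrier S[ E ]

  infix 4 _≈_
  _≈_ : ∀ {E} → Rel (Str E) ℓ
  _≈_ {E} = Setoid._≈_ S[ E ]

  field
    relabel      : ∀ {E F} → El E ↔ El F → Str E → Str F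
    relabel-cong : ∀ {E F} {σ τ : El E ↔ El F} {X Y : Str E} →
                   to σ ≗ to τ → X ≈ Y → relabel {E} {F} σ X ≈ relabel τ Y
    relabel-id   : ∀ {E} (X : Str E) → relabel (↔-id (El E)) X ≈ X
    relabel-∘    : ∀ {E F G} (τ : El F ↔ El G) (σ : El E ↔ El F) (X : Str E) →
                   relabel {E} {G} (τ ↔-∘ σ) X ≈ relabel {F} {G} τ (relabel σ X)

  -- S n = S[{1,…,n}] / Σₙ, and S• = ⨆ₙ S n.

  infix 4 _≅_
  _≅_ : ∀ {n} → Rel (Str ⟨ n ⟩) ℓ
  _≅_ {n} X Y = ∃ λ (σ : Fin n ↔ Fin n) → relabel {⟨ n ⟩} {⟨ n ⟩} σ X ≈ Y

  S : ℕ → Setoid c ℓ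
  S n = record
    { Carrier       = Str ⟨ n ⟩
    ; _≈_           = _≅_
    ; isEquivalence = record
      { refl  = ↔-id (Fin n) , relabel-id _
      ; sym   = λ { {X} {Y} (σ , σX≈Y) → ↔-sym σ , (begin
          relabel (↔-sym σ) Y              ≈⟨ relabel-cong (λ _ → refl) σX≈Y ⟨
          relabel (↔-sym σ) (relabel σ X)  ≈⟨ relabel-∘ (↔-sym σ) σ X ⟨
          relabel (↔-sym σ ↔-∘ σ) X        ≈⟨ relabel-cong (strictlyInverseʳ σ) (Setoid.refl S[ ⟨ n ⟩ ]) ⟩
          relabel (↔-id (Fin n)) X         ≈⟨ relabel-id X ⟩
          X                                ∎) }
      ; trans = λ { {X} {Y} {Z} (σ , σX≈Y) (τ , τY≈Z) → τ ↔-∘ σ , (begin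
          relabel (τ ↔-∘ σ) X      ≈⟨ relabel-∘ τ σ X ⟩
          relabel τ (relabel σ X)  ≈⟨ relabel-cong (λ _ → refl) σX≈Y ⟩
          relabel τ Y              ≈⟨ τY≈Z ⟩
          Z                        ∎) }
      }
    }
    where open import Relation.Binary.Reasoning.Setoid S[ ⟨ n ⟩ ]

  data _≅•_ : Rel (∃ λ n → Str ⟨ n ⟩) (c ⊔ ℓ) where
    iso : ∀ {n} {X Y : Str ⟨ n ⟩} → X ≅ Y → (n , X) ≅• (n , Y)

  S• : Setoid c (c ⊔ ℓ)
  S• = record
    { Carrier       = ∃ λ n → Str ⟨ n ⟩
    ; _≈_           = _≅•_
    ; isEquivalence = record
      { refl  = λ { {n , _} → iso (Setoid.refl (S n)) }
      ; sym   = λ { (iso {n} X≅Y) → iso (Setoid.sym (S n) X≅Y) }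
      ; trans = λ { (iso {n} X≅Y) (iso Y≅Z) → iso (Setoid.trans (S n) X≅Y Y≅Z) }
      }
    }

  -- The class in S n of a structure on an n-element set; it does not depend,
  -- up to ≅, on the chosen bijection.

  class : ∀ {E n} → El E ↔ Fin n → Str E → Str ⟨ n ⟩
  class σ X = relabel σ X

  class• : ∀ {E} → Str E → Setoid.Carrier S•
  class• {E} X = size E , class (enum E) X

record MinorsSystem (c ℓ : Level) : Set (lsuc (0ℓ ⊔ c ⊔ ℓ)) where
  infixl 8 _∣_ _/_
  infixl 7 _⊕_

  field
    species : Species c ℓ

  open Species species public

  field
    _∣_ : ∀ {E} → Str E → (A : Subset E) → Str (sub E A)
    _/_ : ∀ {E} → Str E → (A : Subset E) → Str (sub E (∁ A))
    _⊕_ : ∀ {E} → Str E → Str ∅ → Str E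
    𝟙   : Str ∅

    ∣-cong : ∀ {E} {X Y : Str E} (A : Subset E) → X ≈ Y → X ∣ A ≈ Y ∣ A
    /-cong : ∀ {E} {X Y : Str E} (A : Subset E) → X ≈ Y → X / A ≈ Y / A
    ⊕-cong : ∀ {E} {X X′ : Str E} {Y Y′ : Str ∅} → X ≈ X′ → Y ≈ Y′ → X ⊕ Y ≈ X′ ⊕ Y′

    ∣-relabel : ∀ {E F} (σ : El E ↔ El F) (A : Subset E) (B : Subset F) (A≗Bσ : A ≗ B ∘ to σ)
                (X : Str E) →
                relabel (restrict↔ σ A≗Bσ) (X ∣ A) ≈ relabel {F = F} σ X ∣ B
    /-relabel : ∀ {E F} (σ : El E ↔ El F) (A : Subset E) (B : Subset F) (A≗Bσ : A ≗ B ∘ to σ)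
                (X : Str E) →
                relabel (restrict↔ σ (λ e → cong not (A≗Bσ e))) (X / A) ≈ relabel {F = F} σ X / B
    -- The bijections of ∅ act trivially, so only the left summand of ⊕ is
    -- relabelled.
    ⊕-relabel : ∀ {E F} (σ : El E ↔ El F) (X : Str E) (Y : Str ∅) →
                relabel {E} {F} σ (X ⊕ Y) ≈ relabel σ X ⊕ Y

    ∣-∣ : ∀ {E} (A B : Subset E) → Disjoint E A B → (X : Str E) →
          relabel (restrict-restrict↔ E A B) (X ∣ (A ∪ B) ∣ (A ↾ (A ∪ B))) ≈ X ∣ A
    /-∣ : ∀ {E} (A B : Subset E) (A#B : Disjoint E A B) (X : Str E) →
          relabel {F = sub E B} (contract-restrict↔ E A B A#B) (X / A ∣ (B ↾ ∁ A)) ≈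
          relabel (restrict-contract↔ E A B A#B) (X ∣ (A ∪ B) / (A ↾ (A ∪ B)))
    /-/ : ∀ {E} (A B : Subset E) → Disjoint E A B → (X : Str E) →
          relabel (contract-contract↔ E A B) (X / A / (B ↾ ∁ A)) ≈ X / (A ∪ B)

    -- ∁ (none E) computes to full E.
    ∣-full : ∀ {E} (X : Str E) → relabel full↔ (X ∣ full E) ≈ X
    /-none : ∀ {E} (X : Str E) → relabel full↔ (X / none E) ≈ X

    ⊕-assoc     : ∀ {E} (X : Str E) (Y Z : Str ∅) → X ⊕ (Y ⊕ Z) ≈ (X ⊕ Y) ⊕ Z
    ⊕-comm      : (X Y : Str ∅) → X ⊕ Y ≈ Y ⊕ X
    ⊕-identityʳ : ∀ {E} (X : Str E) → X ⊕ 𝟙 ≈ X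

    ⊕-∣ : ∀ {E} (X : Str E) (Y : Str ∅) (A : Subset E) → (X ⊕ Y) ∣ A ≈ (X ∣ A) ⊕ Y
    ⊕-/ : ∀ {E} (X : Str E) (Y : Str ∅) (A : Subset E) → (X ⊕ Y) / A ≈ (X / A) ⊕ Y

infixl 7 _∙_

data Word {g} (G : Set g) : Set g where
  gen : G → Word G
  ε   : Word G
  _∙_ : Word G → Word G → Word G

module Presentation {g h r} (G : Setoid g h) (R : Rel (Word (Setoid.Carrier G)) r) where
  open Setoid G using () renaming (Carrier to ∣G∣; _≈_ to _≈G_)

  infix 4 _∼_
  data _∼_ : Rel (Word ∣G∣) (g ⊔ h ⊔ r) where
    ∼-refl      : ∀ {u} → u ∼ u
    ∼-sym       : ∀ {u v} → u ∼ v → v ∼ u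
    ∼-trans     : ∀ {u v w} → u ∼ v → v ∼ w → u ∼ w
    ∙-cong      : ∀ {u u′ v v′} → u ∼ u′ → v ∼ v′ → u ∙ v ∼ u′ ∙ v′
    ∙-assoc     : ∀ u v w → (u ∙ v) ∙ w ∼ u ∙ (v ∙ w)
    ∙-identityˡ : ∀ u → ε ∙ u ∼ u
    ∙-comm      : ∀ u v → u ∙ v ∼ v ∙ u
    gen-cong    : ∀ {x y} → x ≈G y → gen x ∼ gen y
    relation    : ∀ {u v} → R u v → u ∼ v

  presented : CommutativeMonoid g (g ⊔ h ⊔ r)
  presented = record
    { Carrier = Word ∣G∣
    ; _≈_     = _∼_
    ; _∙_     = _∙_
    ; ε       = ε
    ; isCommutativeMonoid = record
      { isMonoid = record
        { isSemigroup = record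
          { isMagma = record
            { isEquivalence = record { refl = ∼-refl ; sym = ∼-sym ; trans = ∼-trans }
            ; ∙-cong        = ∙-cong
            }
          ; assoc = ∙-assoc
          }
        ; identity = ∙-identityˡ , λ u → ∼-trans (∙-comm u ε) (∙-identityˡ u)
        }
      ; comm = ∙-comm
      }
    }

open Presentation using (presented) public

extend : ∀ {g c ℓ} {G : Set g} (M : CommutativeMonoid c ℓ) →
         (G → CommutativeMonoid.Carrier M) → Word G → CommutativeMonoid.Carrier M
extend M f (gen x) = f x
extend M f ε       = CommutativeMonoid.ε M
extend M f (u ∙ v) = CommutativeMonoid._∙_ M (extend M f u) (extend M f v)

IsSingleton : ∀ {A : Set} → A → Set
IsSingleton a = ∀ x → a ≡ x

singleton↔ : ∀ {A : Set} {a : A} → IsSingleton a → A ↔ Fin 1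
singleton↔ {a = a} a≡ = mk↔ₛ′ (λ _ → zero) (λ _ → a) (λ { zero → refl }) a≡

module _ (E : FinSet) (e f : El E) (e≢f : e ≢ f) (E≡ef : ∀ x → x ≡ e ⊎ x ≡ f) where

  restrict-one : El (sub E ⁅ E ∋ e ⁆) ↔ Fin 1
  restrict-one = singleton↔ {a = e , fromWitness {a? = decEq E e e} refl} λ (x , x∈e) →
    subset≡ ⁅ E ∋ e ⁆ (toWitness {a? = decEq E e x} x∈e)

  contract-one : El (sub E (∁ ⁅ E ∋ e ⁆)) ↔ Fin 1
  contract-one = singleton↔ {a = f , fromWitnessFalse {a? = decEq E e f} e≢f} λ (x , x∉e) →
    subset≡ (∁ ⁅ E ∋ e ⁆) (other x (toWitnessFalse {a? = decEq E e x} x∉e))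
    where
    other : ∀ x → e ≢ x → f ≡ x
    other x e≢x with E≡ef x
    ... | inj₁ x≡e = ⊥-elim (e≢x (sym x≡e))
    ... | inj₂ x≡f = sym x≡f

module _ {c ℓ} (𝐒 : MinorsSystem c ℓ) where
  open MinorsSystem 𝐒

  data GrothendieckRelation : Rel (Word (Setoid.Carrier S•)) (lsuc 0ℓ ⊔ c) where
    minors : ∀ {E} (X : Str E) (A : Subset E) →
             GrothendieckRelation (gen (class• X)) (gen (class• (X ∣ A)) ∙ gen (class• (X / A)))
    sum    : ∀ {E} (X : Str E) (Y : Str ∅) →
             GrothendieckRelation (gen (class• (X ⊕ Y))) (gen (class• X))
    unit   : GrothendieckRelation (gen (class• 𝟙)) ε

  U : CommutativeMonoid c (lsuc 0ℓ ⊔ c ⊔ ℓ)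
  U = presented S• GrothendieckRelation

  data OneElementRelation : Rel (Word (Setoid.Carrier (S 1))) (lsuc 0ℓ ⊔ c) where
    exchange : ∀ {E} (e f : El E) (e≢f : e ≢ f) (E≡ef : ∀ x → x ≡ e ⊎ x ≡ f) (X : Str E) →
               let f≢e = λ f≡e → e≢f (sym f≡e)
                   E≡fe = λ x → swap (E≡ef x)
               in OneElementRelation
                    (gen (class (restrict-one E e f e≢f E≡ef) (X ∣ ⁅ E ∋ e ⁆)) ∙
                     gen (class (contract-one E e f e≢f E≡ef) (X / ⁅ E ∋ e ⁆)))
                    (gen (class (restrict-one E f e f≢e E≡fe) (X ∣ ⁅ E ∋ f ⁆)) ∙
                     gen (class (contract-one E f e f≢e E≡fe) (X / ⁅ E ∋ f ⁆)))
    sum      : (X : Str ⟨ 1 ⟩) (Y : Str ∅) → OneElementRelation (gen (X ⊕ Y)) (gen X)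

  OneElementMonoid : CommutativeMonoid c (lsuc 0ℓ ⊔ c ⊔ ℓ)
  OneElementMonoid = presented (S 1) OneElementRelation

  natural : CommutativeMonoid.Carrier OneElementMonoid → CommutativeMonoid.Carrier U
  natural = extend U (λ X → gen (1 , X))

{-# OPTIONS --safe #-}
module Submission where

-- The inverse sends [X], for X ∈ S[E], to the product of the one-element minors
-- X / {e₁,…,eᵢ₋₁} | eᵢ along an ordering e₁,…,eₙ of E.  Swapping two neighbours
-- of the ordering is an instance of the exchange relation for the two-element
-- minor X / {e₁,…,eᵢ₋₁} | {eᵢ,eᵢ₊₁}, so the product does not depend on the
-- ordering.  For A ⊆ E, an ordering that starts with A gives the product of
-- X | A followed by that of X / A.  Conversely, in U(S) the relation
-- [X / B] = [X / B | e] [X / (B ⊔ e)] telescopes along an ordering to express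
-- [X] as the product of its one-element minors, the last factor lying in S[∅]
-- and hence being trivial.

open import Defs
open import Algebra.Bundles using (CommutativeMonoid)
open import Algebra.Morphism.Structures using (IsMonoidIsomorphism)
open import Data.Bool.Base using (Bool; true; false; not; _∨_; _∧_; T)
open import Data.Bool.Properties using (∨-assoc; ∨-comm; ∨-identityʳ; T?)
open import Data.Empty using (⊥; ⊥-elim)
open import Data.Fin.Base using (Fin; zero; suc)
open import Data.Fin.Permutation using (↔⇒≡)
open import Data.List.Base using (List; []; _∷_; _++_; map; allFin)
open import Data.List.Membership.Propositional using (_∈_)
open import Data.List.Membership.Propositional.Properties using (∈-map⁺; ∈-allFin; ∈-++⁺ˡ; ∈-++⁺ʳ)
open import Data.List.Relation.Binary.Permutation.Propositional using (_↭_; refl; prep; swap; trans)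
open import Data.List.Relation.Binary.Permutation.Propositional.Properties using (++-comm)
open import Data.List.Relation.Unary.Any using (here; there)
open import Data.Nat.Base using (ℕ; suc)
open import Data.Product.Base using (_,_; proj₁; proj₂)
open import Data.Sum.Base as Sum using (_⊎_; inj₁; inj₂)
open import Data.Unit.Base using (tt)
open import Function.Base using (_∘_; id)
open import Function.Bundles using (_↔_; Injection; Inverse)
open import Function.Construct.Composition using (_↔-∘_)
open import Function.Construct.Identity using (↔-id)
open import Function.Construct.Symmetry using (↔-sym)
open import Function.Properties.Inverse using (↔⇒↣)
open import Level using (0ℓ; _⊔_) renaming (suc to lsuc)
open import Relation.Binary.Bundles using (Setoid)
open import Relation.Binary.PropositionalEquality as ≡ using (_≡_; _≢_; _≗_; cong; cong₂; subst)
open import Relation.Nullary.Decidable using (yes; no; toWitness; fromWitness)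
import Relation.Binary.Reasoning.Setoid as SetoidReasoning

open Inverse using (to; from; strictlyInverseˡ; strictlyInverseʳ)

-- Subsets as Boolean predicates, and singletons.

infix 4 _⊆_
infixr 7 _∖_

_⊆_ : ∀ {A : Set} → (A → Bool) → (A → Bool) → Set
A ⊆ B = ∀ e → T (A e) → T (B e)

_∖_ : ∀ {A : Set} → (A → Bool) → (A → Bool) → (A → Bool)
(A ∖ B) e = A e ∧ not (B e)

T-not : ∀ {a} → T a → T (not a) → ⊥
T-not {true} _ ()

not-T : ∀ {a} → (T a → ⊥) → T (not a)
not-T {true}  ¬a = ¬a tt
not-T {false} _  = tt

T-antisym : ∀ a b → (T a → T b) → (T b → T a) → a ≡ b
T-antisym true  true  _   _   = ≡.refl
T-antisym true  false a⇒b _   = ⊥-elim (a⇒b tt)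
T-antisym false true  _   b⇒a = ⊥-elim (b⇒a tt)
T-antisym false false _   _   = ≡.refl

T-∨ˡ : ∀ {a b} → T a → T (a ∨ b)
T-∨ˡ {true} _ = tt

T-∨ʳ : ∀ a {b} → T b → T (a ∨ b)
T-∨ʳ true  _ = tt
T-∨ʳ false b = b

T-∨-elim : ∀ {a b} {P : Set} → (T a → P) → (T b → P) → T (a ∨ b) → P
T-∨-elim {true}  f _ = f
T-∨-elim {false} _ g = g

∪-∖ : ∀ {E : Set} {A B : E → Bool} → A ⊆ B → A ∪ (B ∖ A) ≗ B
∪-∖ {A = A} {B} A⊆B e with A e | B e | A⊆B e
... | true  | true  | _   = ≡.refl
... | true  | false | a⇒b = ⊥-elim (a⇒b tt)
... | false | true  | _   = ≡.refl
... | false | false | _   = ≡.refl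

∖-outside : ∀ {E : Set} (A B : E → Bool) → (A ∖ B) ↾ ∁ B ≗ A ↾ ∁ B
∖-outside A B (e , e∉B) with A e | B e
... | true  | false = ≡.refl
... | false | false = ≡.refl

∪-∖-absorb : ∀ {E : Set} (A B : E → Bool) → A ∪ (B ∖ A) ≗ A ∪ B
∪-∖-absorb A B e with A e | B e
... | true  | _     = ≡.refl
... | false | true  = ≡.refl
... | false | false = ≡.refl

∖-disjoint : ∀ {E : Set} (A B : E → Bool) → ∀ e → T (A e) → T ((B ∖ A) e) → ⊥
∖-disjoint A B e e∈A e∈B∖A with A e | B e
∖-disjoint A B e e∈A () | true | true
∖-disjoint A B e e∈A () | true | false

module _ (E : FinSet) where

  ∈⁅⁆⇒≡ : ∀ {e x} → T (⁅ E ∋ e ⁆ x) → e ≡ x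
  ∈⁅⁆⇒≡ {e} {x} = toWitness {a? = decEq E e x}

  ≡⇒∈⁅⁆ : ∀ {e x} → e ≡ x → T (⁅ E ∋ e ⁆ x)
  ≡⇒∈⁅⁆ {e} {x} = fromWitness {a? = decEq E e x}

  ⁅⁆⊆ : ∀ {A : Subset E} {e} → T (A e) → ⁅ E ∋ e ⁆ ⊆ A
  ⁅⁆⊆ {A} e∈A x x∈e = subst (T ∘ A) (∈⁅⁆⇒≡ x∈e) e∈A

  ∪-absorb : ∀ {A : Subset E} {e} → T (A e) → A ∪ ⁅ E ∋ e ⁆ ≗ A
  ∪-absorb {A} {e} e∈A x =
    T-antisym _ _ (T-∨-elim id (⁅⁆⊆ {A} e∈A x)) T-∨ˡ

⁅⁆-injective : ∀ E F {f : El E → El F} → (∀ {x y} → f x ≡ f y → x ≡ y) →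
               ∀ e → ⁅ E ∋ e ⁆ ≗ ⁅ F ∋ f e ⁆ ∘ f
⁅⁆-injective E F {f} f-inj e x =
  T-antisym _ _ (≡⇒∈⁅⁆ F ∘ cong f ∘ ∈⁅⁆⇒≡ E) (≡⇒∈⁅⁆ E ∘ f-inj ∘ ∈⁅⁆⇒≡ F)

to-injective : ∀ {A B : Set} (σ : A ↔ B) {x y} → to σ x ≡ to σ y → x ≡ y
to-injective σ = Injection.injective (↔⇒↣ σ)

-- Listing a finite set, and the subsets built up by lists.

adjoin : ∀ E → Subset E → List (El E) → Subset E
adjoin E A []      = A
adjoin E A (e ∷ l) = adjoin E (A ∪ ⁅ E ∋ e ⁆) l

elements : ∀ E → List (El E)
elements E = map (from (enum E)) (allFin (size E))

∈-elements : ∀ E e → e ∈ elements E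
∈-elements E e = subst (_∈ elements E) (strictlyInverseʳ (enum E) e)
  (∈-map⁺ (from (enum E)) (∈-allFin (to (enum E) e)))

⊆-adjoin : ∀ E {A : Subset E} l → A ⊆ adjoin E A l
⊆-adjoin E []      e e∈A = e∈A
⊆-adjoin E (x ∷ l) e e∈A = ⊆-adjoin E l e (T-∨ˡ e∈A)

∈⇒∈adjoin : ∀ E {A : Subset E} {l e} → e ∈ l → T (adjoin E A l e)
∈⇒∈adjoin E {A} {x ∷ l} {e} (here e≡x)  =
  ⊆-adjoin E l e (T-∨ʳ (A e) (≡⇒∈⁅⁆ E (≡.sym e≡x)))
∈⇒∈adjoin E {A} {x ∷ l} {e} (there e∈l) = ∈⇒∈adjoin E e∈l

adjoin⊆ : ∀ E {A C : Subset E} (l : List (El (sub E C))) → A ⊆ C →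
          adjoin E A (map proj₁ l) ⊆ C
adjoin⊆ E []            A⊆C = A⊆C
adjoin⊆ E {A} {C} ((x , x∈C) ∷ l) A⊆C =
  adjoin⊆ E l λ e → T-∨-elim (A⊆C e) (⁅⁆⊆ E {C} x∈C e)

-- In a product that lists `C` first, this identifies the set contracted by the time the list of `C`
-- is finished.
adjoin-elements : ∀ E (C : Subset E) → adjoin E (none E) (map proj₁ (elements (sub E C))) ≗ C
adjoin-elements E C e = T-antisym _ _
  (adjoin⊆ E (elements (sub E C)) (λ _ ()) e)
  (λ e∈C → ∈⇒∈adjoin E (∈-map⁺ proj₁ (∈-elements (sub E C) (e , e∈C))))

opaque
  subset-size : ∀ E → Subset E → ℕ
  subset-size E A = size (sub E A)

  subset-enumeration : ∀ E A → El (sub E A) ↔ Fin (subset-size E A)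
  subset-enumeration E A = enum (sub E A)

-- A copy of sub E A whose enumeration is opaque: deciding the equality of two
-- finite sets sub E A and sub F B unfolds their enumerations, which are huge.

subset : ∀ E → Subset E → FinSet
subset E A = record { El = El (sub E A) ; size = subset-size E A ; enum = subset-enumeration E A }

module _ {c ℓ} (𝐒 : MinorsSystem c ℓ) where
  open MinorsSystem 𝐒

  -- Labelled structures, their isomorphisms and their minors.

  ≈-refl : ∀ {E} {X : Str E} → X ≈ X
  ≈-refl {E} = Setoid.refl S[ E ]

  ≈-sym : ∀ {E} {X Y : Str E} → X ≈ Y → Y ≈ X
  ≈-sym {E} = Setoid.sym S[ E ]

  ≈-trans : ∀ {E} {X Y Z : Str E} → X ≈ Y → Y ≈ Z → X ≈ Z
  ≈-trans {E} = Setoid.trans S[ E ]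

  -- Labelled minors.  A minor of a structure labelled by L is again labelled by
  -- L, so that iterated minors need no nested subsets.  Without η, the ground
  -- sets of P ∥ A and P // A are never unfolded during unification.

  record Over (L : Set) : Set (lsuc 0ℓ ⊔ c) where
    no-eta-equality
    constructor over
    field
      {ground}  : FinSet
      label     : El ground → L
      structure : Str ground

  open Over

  infixl 8 _∥_ _//_

  _∥_ : ∀ {L} → Over L → (L → Bool) → Over L
  (P ∥ A) .ground    = subset (ground P) (A ∘ label P)
  (P ∥ A) .label     = label P ∘ proj₁
  (P ∥ A) .structure = relabel {sub (ground P) (A ∘ label P)} (↔-id _) (structure P ∣ (A ∘ label P))

  _//_ : ∀ {L} → Over L → (L → Bool) → Over L
  (P // A) .ground    = subset (ground P) (∁ (A ∘ label P))
  (P // A) .label     = label P ∘ proj₁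
  (P // A) .structure = relabel {sub (ground P) (∁ (A ∘ label P))} (↔-id _) (structure P / (A ∘ label P))

  -- The label map `f` allows a minor labelled by its own subset type to be compared with the same
  -- minor labelled by the ambient set, as in `⟪⟫-∣` and `⟪⟫-/`.
  record Iso {L M : Set} (f : L → M) (P : Over L) (Q : Over M) : Set ℓ where
    constructor along
    field
      σ        : El (ground P) ↔ El (ground Q)
      labels   : f ∘ label P ≗ label Q ∘ to σ
      relabels : relabel {ground P} {ground Q} σ (structure P) ≈ structure Q

  infix 4 _≃_
  _≃_ : ∀ {L} → Over L → Over L → Set ℓ
  _≃_ = Iso id

  ≃-refl : ∀ {L} {P : Over L} → P ≃ P
  ≃-refl {P = P} = along (↔-id _) (λ _ → ≡.refl) (relabel-id (structure P))

  Iso-trans : ∀ {L M N} {f : L → M} {g : M → N} {P Q R} →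
              Iso f P Q → Iso g Q R → Iso (g ∘ f) P R
  Iso-trans {g = g} {P} {Q} {R} (along σ f≗ p) (along τ g≗ q) = along (τ ↔-∘ σ)
    (λ e → ≡.trans (cong g (f≗ e)) (g≗ (to σ e)))
    (≈-trans (relabel-∘ {ground P} {ground Q} {ground R} τ σ (structure P))
      (≈-trans (relabel-cong {ground Q} {ground R} (λ _ → ≡.refl) p) q))

  ≃-trans : ∀ {L} {P Q R : Over L} → P ≃ Q → Q ≃ R → P ≃ R
  ≃-trans = Iso-trans {f = id} {id}

  ≃-sym : ∀ {L} {P Q : Over L} → P ≃ Q → Q ≃ P
  ≃-sym {P = P} {Q} (along σ p≗q p) = along (↔-sym σ)
    (λ f → ≡.trans (cong (label Q) (≡.sym (strictlyInverseˡ σ f))) (≡.sym (p≗q (from σ f))))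
    (≈-trans (relabel-cong {ground Q} {ground P} (λ _ → ≡.refl) (≈-sym p))
      (≈-trans (≈-sym (relabel-∘ {ground P} {ground Q} {ground P} (↔-sym σ) σ (structure P)))
        (≈-trans (relabel-cong {ground P} {ground P} (strictlyInverseʳ σ) ≈-refl)
          (relabel-id (structure P)))))

  -- Since `Over` has no η, this identity relabelling stands in for a definitional equality.
  over-≃ : ∀ {L} (P : Over L) → over {ground = ground P} (label P) (structure P) ≃ P
  over-≃ P = along (↔-id _) (λ _ → ≡.refl) (relabel-id (structure P))

  -- Unlike P ∥ A and P // A, these live on sub E A itself, as the axioms do.

  module _ {L : Set} (E : FinSet) (l : El E → L) (X : Str E) (A : Subset E) where

    restrict₀ : Over L
    restrict₀ = over {ground = sub E A} (l ∘ proj₁) (X ∣ A)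

    contract₀ : Over L
    contract₀ = over {ground = sub E (∁ A)} (l ∘ proj₁) (X / A)

  module _ {L M : Set} (E : FinSet) (l : El E → L) (X : Str E) {f : L → M} {Q : Over M}
           (p : Iso f (over {ground = E} l X) Q) (A : Subset E) {B : M → Bool}
           (A≗B : A ≗ B ∘ f ∘ l) where
    open Iso p

    private
      B′ : Subset (ground Q)
      B′ = B ∘ label Q

      A≗B′σ : A ≗ B′ ∘ to σ
      A≗B′σ e = ≡.trans (A≗B e) (cong B (labels e))

    restrict₀-cong : Iso f (restrict₀ E l X A) (Q ∥ B)
    restrict₀-cong = Iso-trans {f = f} {id} {Q = restrict₀ (ground Q) (label Q) (structure Q) B′}
      (along (restrict↔ σ A≗B′σ) (labels ∘ proj₁)
        (≈-trans (∣-relabel {E} {ground Q} σ A B′ A≗B′σ X) (∣-cong {ground Q} B′ relabels)))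
      -- Passage from `sub` to its opaque copy `subset`: both have the same elements.
      (along (↔-id _) (λ _ → ≡.refl) ≈-refl)

    contract₀-cong : Iso f (contract₀ E l X A) (Q // B)
    contract₀-cong = Iso-trans {f = f} {id} {Q = contract₀ (ground Q) (label Q) (structure Q) B′}
      (along (restrict↔ σ (λ e → cong not (A≗B′σ e))) (labels ∘ proj₁)
        (≈-trans (/-relabel {E} {ground Q} σ A B′ A≗B′σ X) (/-cong {ground Q} B′ relabels)))
      (along (↔-id _) (λ _ → ≡.refl) ≈-refl)

  module _ {L : Set} (P : Over L) {A : L → Bool} (A′ : Subset (ground P)) (A′≗A : A′ ≗ A ∘ label P) where

    restrict-≃ : restrict₀ (ground P) (label P) (structure P) A′ ≃ P ∥ A
    restrict-≃ = restrict₀-cong (ground P) (label P) (structure P) (over-≃ P) A′ A′≗A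

    contract-≃ : contract₀ (ground P) (label P) (structure P) A′ ≃ P // A
    contract-≃ = contract₀-cong (ground P) (label P) (structure P) (over-≃ P) A′ A′≗A

  module _ {L M : Set} {f : L → M} {P : Over L} {Q : Over M} (p : Iso f P Q)
           {A : L → Bool} {B : M → Bool} (A≗B : A ∘ label P ≗ B ∘ f ∘ label P) where

    -- Agreement is asked on the labels of `P` alone, so that after a contraction a subset may be
    -- altered on the contracted elements.
    ∥-cong : Iso f (P ∥ A) (Q ∥ B)
    ∥-cong = Iso-trans {f = id} {f} (≃-sym (restrict-≃ P _ (λ _ → ≡.refl)))
      (restrict₀-cong (ground P) (label P) (structure P)
        (Iso-trans {f = id} {f} (over-≃ P) p) _ A≗B)

    //-cong : Iso f (P // A) (Q // B)
    //-cong = Iso-trans {f = id} {f} (≃-sym (contract-≃ P _ (λ _ → ≡.refl)))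
      (contract₀-cong (ground P) (label P) (structure P)
        (Iso-trans {f = id} {f} (over-≃ P) p) _ A≗B)

  -- The axioms on iterated minors, for labelled structures.

  module _ {L : Set} (E : FinSet) (l : El E → L) (X : Str E) {P : Over L} (p : over {ground = E} l X ≃ P)
           {A B : Subset E} (A#B : Disjoint E A B) (A′ B′ : L → Bool)
           (A≗A′ : A ≗ A′ ∘ l) (B≗B′ : B ≗ B′ ∘ l) where

    private
      A∪B≗A′∪B′ : A ∪ B ≗ (A′ ∪ B′) ∘ l
      A∪B≗A′∪B′ e = cong₂ _∨_ (A≗A′ e) (B≗B′ e)

      restrict-∪ : over {ground = sub E (A ∪ B)} (l ∘ proj₁) (X ∣ (A ∪ B)) ≃ P ∥ (A′ ∪ B′)
      restrict-∪ = restrict₀-cong E l X p (A ∪ B) A∪B≗A′∪B′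

      contract-A : over {ground = sub E (∁ A)} (l ∘ proj₁) (X / A) ≃ P // A′
      contract-A = contract₀-cong E l X p A A≗A′

    restrict-restrict : P ∥ (A′ ∪ B′) ∥ A′ ≃ P ∥ A′
    restrict-restrict = ≃-trans
      (≃-sym (restrict₀-cong (sub E (A ∪ B)) (l ∘ proj₁) (X ∣ (A ∪ B)) restrict-∪
        (A ↾ (A ∪ B)) (A≗A′ ∘ proj₁)))
      (≃-trans {Q = restrict₀ E l X A}
        (along (restrict-restrict↔ E A B) (λ _ → ≡.refl) (∣-∣ {E} A B A#B X))
        (restrict₀-cong E l X p A A≗A′))

    contract-contract : P // A′ // B′ ≃ P // (A′ ∪ B′)
    contract-contract = ≃-trans
      (≃-sym (contract₀-cong (sub E (∁ A)) (l ∘ proj₁) (X / A) contract-A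
        (B ↾ ∁ A) (B≗B′ ∘ proj₁)))
      (≃-trans {Q = contract₀ E l X (A ∪ B)}
        (along (contract-contract↔ E A B) (λ _ → ≡.refl) (/-/ {E} A B A#B X))
        (contract₀-cong E l X p (A ∪ B) A∪B≗A′∪B′))

    contract-restrict : P // A′ ∥ B′ ≃ P ∥ (A′ ∪ B′) // A′
    contract-restrict = ≃-trans
      (≃-sym (restrict₀-cong (sub E (∁ A)) (l ∘ proj₁) (X / A) contract-A
        (B ↾ ∁ A) (B≗B′ ∘ proj₁)))
      (≃-trans {Q = over {ground = sub E B} (l ∘ proj₁) Y}
        (along (contract-restrict↔ E A B A#B) (λ _ → ≡.refl) (/-∣ {E} A B A#B X))
        (≃-trans
          -- The axiom equates two relabellings onto `sub E B`; the second one is undone here.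
          (≃-sym (along {P = Z} (restrict-contract↔ E A B A#B) (λ _ → ≡.refl) ≈-refl))
          (contract₀-cong (sub E (A ∪ B)) (l ∘ proj₁) (X ∣ (A ∪ B)) restrict-∪
            (A ↾ (A ∪ B)) (A≗A′ ∘ proj₁))))
      where
      Y : Str (sub E B)
      Y = relabel {sub (sub E (A ∪ B)) (∁ (A ↾ (A ∪ B)))} {sub E B}
        (restrict-contract↔ E A B A#B) (X ∣ (A ∪ B) / (A ↾ (A ∪ B)))

      Z : Over L
      Z = contract₀ (sub E (A ∪ B)) (l ∘ proj₁) (X ∣ (A ∪ B)) (A ↾ (A ∪ B))

  module _ {L : Set} (P : Over L) {A : L → Bool} where

    ∥-full : (∀ x → T (A (label P x))) → P ∥ A ≃ P
    ∥-full A-full = ≃-trans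
      (≃-sym (restrict-≃ P {A} (full (ground P))
        (λ x → T-antisym _ _ (λ _ → A-full x) (λ _ → tt))))
      (along full↔ (λ _ → ≡.refl) (∣-full {ground P} (structure P)))

    //-none : (∀ x → T (A (label P x)) → ⊥) → P // A ≃ P
    //-none A-none = ≃-trans
      (≃-sym (contract-≃ P {A} (none (ground P)) (λ x → T-antisym _ _ (λ ()) (A-none x))))
      (along full↔ (λ _ → ≡.refl) (/-none {ground P} (structure P)))

  -- No label in `A` survives the contraction. This makes a second subset disjoint from `A`, as the
  -- axioms require.
  outside : ∀ {L} (P : Over L) (A B : L → Bool) → B ∘ label (P // A) ≗ (B ∖ A) ∘ label (P // A)
  outside P A B (x , x∉A) = ≡.sym (∖-outside B A (label P x , x∉A))

  module _ {L : Set} (P : Over L) (A B : L → Bool) where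

    -- Here and in the next two lemmas, splitting off the part of `B` outside `A` reduces to the
    -- axiom for disjoint subsets.
    ∥-∥ : A ⊆ B → P ∥ B ∥ A ≃ P ∥ A
    ∥-∥ A⊆B = ≃-trans
      (∥-cong (∥-cong ≃-refl (λ x → ≡.sym (∪-∖ A⊆B (label P x)))) (λ _ → ≡.refl))
      (restrict-restrict _ _ _ (over-≃ P) (∖-disjoint A B ∘ label P) A (B ∖ A)
        (λ _ → ≡.refl) (λ _ → ≡.refl))

    //-// : P // A // B ≃ P // (A ∪ B)
    //-// = ≃-trans (//-cong ≃-refl (outside P A B))
      (≃-trans (contract-contract _ _ _ (over-≃ P) (∖-disjoint A B ∘ label P) A (B ∖ A)
        (λ _ → ≡.refl) (λ _ → ≡.refl))
        (//-cong ≃-refl (∪-∖-absorb A B ∘ label P)))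

    //-∥ : A ⊆ B → P // A ∥ B ≃ P ∥ B // A
    //-∥ A⊆B = ≃-trans (∥-cong ≃-refl (outside P A B))
      (≃-trans (contract-restrict _ _ _ (over-≃ P) (∖-disjoint A B ∘ label P) A (B ∖ A)
        (λ _ → ≡.refl) (λ _ → ≡.refl))
        (//-cong (∥-cong ≃-refl (∪-∖ A⊆B ∘ label P)) (λ _ → ≡.refl)))

  -- Structures labelled by their own ground set.

  ⟪_⟫ : ∀ {E} → Str E → Over (El E)
  ⟪_⟫ {E} X = over {ground = E} id X

  ⟪⟫-∣ : ∀ {E} (X : Str E) (A : Subset E) → Iso proj₁ ⟪ X ∣ A ⟫ (⟪ X ⟫ ∥ A)
  ⟪⟫-∣ {E} X A = Iso-trans {f = proj₁} {id} {Q = restrict₀ E id X A}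
    (along (↔-id _) (λ _ → ≡.refl) (relabel-id (X ∣ A)))
    (restrict₀-cong E id X ≃-refl A (λ _ → ≡.refl))

  ⟪⟫-/ : ∀ {E} (X : Str E) (A : Subset E) → Iso proj₁ ⟪ X / A ⟫ (⟪ X ⟫ // A)
  ⟪⟫-/ {E} X A = Iso-trans {f = proj₁} {id} {Q = contract₀ E id X A}
    (along (↔-id _) (λ _ → ≡.refl) (relabel-id (X / A)))
    (contract₀-cong E id X ≃-refl A (λ _ → ≡.refl))

  -- This ensures that a restriction to a single label has at most one element.
  LabelInjective : ∀ {L} → Over L → Set
  LabelInjective P = ∀ {x y} → label P x ≡ label P y → x ≡ y

  ∥-injective : ∀ {L} (P : Over L) A → LabelInjective P → LabelInjective (P ∥ A)
  ∥-injective P A inj = subset≡ (A ∘ label P) ∘ inj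

  //-injective : ∀ {L} (P : Over L) A → LabelInjective P → LabelInjective (P // A)
  //-injective P A inj = subset≡ (∁ (A ∘ label P)) ∘ inj

  -- Isomorphism classes and one-element factors.

  class-Iso : ∀ {L M} {f : L → M} {P Q} {n} → Iso f P Q →
              (σ : El (ground P) ↔ Fin n) (τ : El (ground Q) ↔ Fin n) →
              class σ (structure P) ≅ class τ (structure Q)
  class-Iso {P = P} {Q} {n} (along ρ _ ρX≈Y) σ τ = π ,
    ≈-trans (≈-sym (relabel-∘ {ground P} {⟨ n ⟩} {⟨ n ⟩} π σ (structure P)))
      (≈-trans (relabel-cong {ground P} {⟨ n ⟩}
          (λ e → cong (to τ ∘ to ρ) (strictlyInverseʳ σ e)) ≈-refl)
        (≈-trans (relabel-∘ {ground P} {ground Q} {⟨ n ⟩} τ ρ (structure P))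
          (relabel-cong {ground Q} {⟨ n ⟩} (λ _ → ≡.refl) ρX≈Y)))
    where
    π : Fin n ↔ Fin n
    π = (τ ↔-∘ ρ) ↔-∘ ↔-sym σ

  size-Iso : ∀ {L M} {f : L → M} {P Q} {m n} → Iso f P Q →
             El (ground P) ↔ Fin m → El (ground Q) ↔ Fin n → m ≡ n
  size-Iso (along ρ _ _) σ τ = ↔⇒≡ ((τ ↔-∘ ρ) ↔-∘ ↔-sym σ)

  module V where
    open Presentation (S 1) (OneElementRelation 𝐒) public
    open CommutativeMonoid (OneElementMonoid 𝐒) public using (identityʳ; setoid)

  open V using (_∼_; ∼-refl; ∼-sym; ∼-trans; ∙-cong)

  -- The junk value ε makes the factors of elements that are already contracted
  -- vanish, so that lists may contain repetitions.

  atomOn : ∀ n E → El E ↔ Fin n → Str E → Word (Str ⟨ 1 ⟩)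
  atomOn 0             E σ X = ε
  atomOn 1             E σ X = gen (class σ X)
  atomOn (suc (suc _)) E σ X = ε

  atomOn-Iso : ∀ {L M} {f : L → M} {P Q} {m n} → Iso f P Q →
               (σ : El (ground P) ↔ Fin m) (τ : El (ground Q) ↔ Fin n) →
               atomOn m (ground P) σ (structure P) ∼ atomOn n (ground Q) τ (structure Q)
  atomOn-Iso {m = m} p σ τ with size-Iso p σ τ
  atomOn-Iso {m = 0}           p σ τ | ≡.refl = ∼-refl
  atomOn-Iso {m = 1}           p σ τ | ≡.refl = V.gen-cong (class-Iso p σ τ)
  atomOn-Iso {m = suc (suc _)} p σ τ | ≡.refl = ∼-refl

  opaque
    atom : ∀ {L} → Over L → Word (Str ⟨ 1 ⟩)
    atom P = atomOn (size (ground P)) (ground P) (enum (ground P)) (structure P)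

    -- The numbering `σ` is arbitrary because the exchange relation uses `restrict-one` and
    -- `contract-one`, not the enumeration stored in the ground set.
    atomOn∼atom : ∀ {L M} {f : L → M} {P : Over L} {Q : Over M} {n} → Iso f P Q →
                  (σ : El (ground P) ↔ Fin n) → atomOn n (ground P) σ (structure P) ∼ atom Q
    atomOn∼atom {Q = Q} p σ = atomOn-Iso p σ (enum (ground Q))

    atom-Iso : ∀ {L M} {f : L → M} {P Q} → Iso f P Q → atom P ∼ atom Q
    atom-Iso {P = P} {Q} p = atomOn-Iso p (enum (ground P)) (enum (ground Q))

    atom-empty : ∀ {L} (P : Over L) → (El (ground P) → ⊥) → atom P ∼ ε
    atom-empty P empty = helper (size (ground P)) (enum (ground P))
      where
      helper : ∀ n σ → atomOn n (ground P) σ (structure P) ∼ ε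
      helper 0             σ = ∼-refl
      helper 1             σ = ⊥-elim (empty (from σ zero))
      helper (suc (suc _)) σ = ∼-refl

  -- Products of one-element minors along a list.

  factor : ∀ E → Over (El E) → Subset E → El E → Word (Str ⟨ 1 ⟩)
  factor E P A e = atom (P // A ∥ ⁅ E ∋ e ⁆)

  -- `A` accumulates the elements contracted so far; `adjoin` computes its value at the end of the
  -- list.
  word : ∀ E → Over (El E) → Subset E → List (El E) → Word (Str ⟨ 1 ⟩)
  word E P A []      = ε
  word E P A (e ∷ l) = factor E P A e ∙ word E P (A ∪ ⁅ E ∋ e ⁆) l

  module _ (E : FinSet) (Z : Over (El E)) (Z-inj : LabelInjective Z) where

    private
      ⁅_⁆ : El E → Subset E
      ⁅ e ⁆ = ⁅ E ∋ e ⁆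

    -- The exchange relation is stated for singletons of the ground set; as labels are injective,
    -- these are the preimages of singletons of labels.
    exchange-atoms : ∀ {x y} (x≢y : x ≢ y) (Z≡xy : ∀ z → z ≡ x ⊎ z ≡ y) →
      atom (Z ∥ ⁅ label Z x ⁆) ∙ atom (Z // ⁅ label Z x ⁆) ∼
      atom (Z ∥ ⁅ label Z y ⁆) ∙ atom (Z // ⁅ label Z y ⁆)
    exchange-atoms {x} {y} x≢y Z≡xy = ∼-trans (∼-sym (half x≢y Z≡xy))
      (∼-trans (V.relation (exchange {E = ground Z} x y x≢y Z≡xy (structure Z)))
        (half (x≢y ∘ ≡.sym) (Sum.swap ∘ Z≡xy)))
      where
      half : ∀ {x y} (x≢y : x ≢ y) (Z≡xy : ∀ z → z ≡ x ⊎ z ≡ y) →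
             gen (class (restrict-one (ground Z) x y x≢y Z≡xy) (structure Z ∣ ⁅ ground Z ∋ x ⁆)) ∙
             gen (class (contract-one (ground Z) x y x≢y Z≡xy) (structure Z / ⁅ ground Z ∋ x ⁆)) ∼
             atom (Z ∥ ⁅ label Z x ⁆) ∙ atom (Z // ⁅ label Z x ⁆)
      half {x} {y} x≢y Z≡xy = ∙-cong
        (atomOn∼atom {P = restrict₀ (ground Z) (label Z) (structure Z) ⁅ ground Z ∋ x ⁆}
          (restrict-≃ Z _ point) (restrict-one (ground Z) x y x≢y Z≡xy))
        (atomOn∼atom {P = contract₀ (ground Z) (label Z) (structure Z) ⁅ ground Z ∋ x ⁆}
          (contract-≃ Z _ point) (contract-one (ground Z) x y x≢y Z≡xy))
        where
        point : ⁅ ground Z ∋ x ⁆ ≗ ⁅ label Z x ⁆ ∘ label Z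
        point = ⁅⁆-injective (ground Z) E Z-inj x

  module _ (E F : FinSet) {f : El E → El F} {P : Over (El E)} {Q : Over (El F)}
           (p : Iso f P Q) (f-inj : ∀ {x y} → f x ≡ f y → x ≡ y) where

    -- Factors match one by one: since `f` is injective, the singleton of `f e` pulls back to the
    -- singleton of `e`.
    word-Iso : ∀ {A B} → A ≗ B ∘ f → ∀ l → word E P A l ∼ word F Q B (map f l)
    word-Iso A≗B []      = ∼-refl
    word-Iso {A} {B} A≗B (e ∷ l) = ∙-cong
      (atom-Iso (∥-cong (//-cong p {A} {B} (A≗B ∘ label P)) {⁅ E ∋ e ⁆} {⁅ F ∋ f e ⁆}
        (⁅⁆-injective E F f-inj e ∘ label (P // A))))
      (word-Iso (λ x → cong₂ _∨_ (A≗B x) (⁅⁆-injective E F f-inj e x)) l)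

  module _ (E : FinSet) (P : Over (El E)) where

    factor-cong : ∀ {A B : Subset E} → A ≗ B → ∀ e → factor E P A e ∼ factor E P B e
    factor-cong {A} {B} A≗B e = atom-Iso
      (∥-cong (//-cong ≃-refl {A} {B} (A≗B ∘ label P)) {⁅ E ∋ e ⁆} {⁅ E ∋ e ⁆} (λ _ → ≡.refl))

    word-cong : ∀ {A B : Subset E} → A ≗ B → ∀ l → word E P A l ∼ word E P B l
    word-cong A≗B []      = ∼-refl
    word-cong {A} {B} A≗B (e ∷ l) = ∙-cong (factor-cong {A} {B} A≗B e)
      (word-cong {A ∪ ⁅ E ∋ e ⁆} {B ∪ ⁅ E ∋ e ⁆} (λ x → cong (_∨ _) (A≗B x)) l)

    word-++ : ∀ A l m → word E P A (l ++ m) ∼ word E P A l ∙ word E P (adjoin E A l) m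
    word-++ A []      m = ∼-sym (V.∙-identityˡ _)
    word-++ A (e ∷ l) m = ∼-trans (∙-cong ∼-refl (word-++ _ l m)) (∼-sym (V.∙-assoc _ _ _))

    -- Nothing over `e` is left in `P // A`, so the factor has an empty ground set.
    factor-∈ : ∀ {A : Subset E} {e} → T (A e) → factor E P A e ∼ ε
    factor-∈ {A} {e} e∈A = atom-empty (P // A ∥ ⁅ E ∋ e ⁆)
      (λ ((x , x∉A) , x∈e) → T-not (⁅⁆⊆ E {A} e∈A (label P x) x∈e) x∉A)

    word-full : ∀ {A : Subset E} → (∀ e → T (A e)) → ∀ l → word E P A l ∼ ε
    word-full A-full []      = ∼-refl
    word-full A-full (e ∷ l) = ∼-trans
      (∙-cong (factor-∈ (A-full e)) (word-full (λ x → T-∨ˡ (A-full x)) l)) (V.∙-identityˡ ε)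

    -- The contracted set stays inside `C`, so contraction commutes with restriction to `C`, and
    -- restricting further to a point of `C` absorbs the latter.
    word-∥ : ∀ {A C : Subset E} → A ⊆ C → (l : List (El (sub E C))) →
             word E (P ∥ C) A (map proj₁ l) ∼ word E P A (map proj₁ l)
    word-∥ A⊆C [] = ∼-refl
    word-∥ {A} {C} A⊆C ((e , e∈C) ∷ l) = ∙-cong
      (atom-Iso (≃-trans (∥-cong (≃-sym (//-∥ P A C A⊆C)) {⁅ E ∋ e ⁆} {⁅ E ∋ e ⁆} (λ _ → ≡.refl))
        (∥-∥ (P // A) ⁅ E ∋ e ⁆ C (⁅⁆⊆ E {C} e∈C))))
      (word-∥ (λ x → T-∨-elim (A⊆C x) (⁅⁆⊆ E {C} e∈C x)) l)

    -- Successive contractions merge, so `C` moves into the accumulated set.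
    word-// : ∀ (A C : Subset E) l → word E (P // C) A l ∼ word E P (C ∪ A) l
    word-// A C []      = ∼-refl
    word-// A C (e ∷ l) = ∙-cong
      (atom-Iso (∥-cong (//-// P C A) {⁅ E ∋ e ⁆} {⁅ E ∋ e ⁆} (λ _ → ≡.refl)))
      (∼-trans (word-// (A ∪ ⁅ E ∋ e ⁆) C l)
        (word-cong (λ x → ≡.sym (∨-assoc (C x) (A x) _)) l))

  -- Independence of the ordering.

  module _ {E : FinSet} (X : Str E) where

    private
      P : Over (El E)
      P = ⟪ X ⟫

      ⁅_⁆ : El E → Subset E
      ⁅ e ⁆ = ⁅ E ∋ e ⁆

    -- Restricting `P // A ∥ D` to `e` gives the first factor, contracting `e` the second. `D` is
    -- given only up to pointwise equality, so that one minor serves both orders of `e` and `f`.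
    two-element-minor : ∀ A D {e f} → D ≗ ⁅ e ⁆ ∪ ⁅ f ⁆ →
      atom (P // A ∥ D ∥ ⁅ e ⁆) ∙ atom (P // A ∥ D // ⁅ e ⁆) ∼
      factor E P A e ∙ factor E P (A ∪ ⁅ e ⁆) f
    two-element-minor A D {e} {f} D≗ef = ∙-cong
      (atom-Iso (∥-∥ (P // A) ⁅ e ⁆ D e⊆D))
      (atom-Iso (≃-trans (≃-sym (//-∥ (P // A) ⁅ e ⁆ D e⊆D))
        (∥-cong (//-// P A ⁅ e ⁆) {D} {⁅ f ⁆} only-f)))
      where
      e⊆D : ⁅ e ⁆ ⊆ D
      e⊆D z z∈e = subst T (≡.sym (D≗ef z)) (T-∨ˡ z∈e)

      -- Once `e` is contracted, `D` meets the remaining labels only in `f`.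
      only-f : D ∘ label (P // A // ⁅ e ⁆) ≗ ⁅ f ⁆ ∘ label (P // A // ⁅ e ⁆)
      only-f (z , z∉e) = ≡.trans (D≗ef _) (T-antisym _ _
        (T-∨-elim (λ z∈e → ⊥-elim (T-not z∈e z∉e)) id) (T-∨ʳ (⁅ e ⁆ _)))

    factor-swap-∈ : ∀ A e f → T (A e) → factor E P A e ∙ factor E P (A ∪ ⁅ e ⁆) f ∼
                                        factor E P A f ∙ factor E P (A ∪ ⁅ f ⁆) e
    factor-swap-∈ A e f e∈A = begin
      factor E P A e ∙ factor E P (A ∪ ⁅ e ⁆) f
        ≈⟨ ∙-cong (factor-∈ E P {A} e∈A)
             (factor-cong E P {A ∪ ⁅ e ⁆} {A} (∪-absorb E {A} e∈A) f) ⟩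
      ε ∙ factor E P A f
        ≈⟨ V.∙-comm _ _ ⟩
      factor E P A f ∙ ε
        ≈⟨ ∙-cong ∼-refl (factor-∈ E P {A ∪ ⁅ f ⁆} (T-∨ˡ e∈A)) ⟨
      factor E P A f ∙ factor E P (A ∪ ⁅ f ⁆) e ∎
      where open SetoidReasoning V.setoid

    -- For distinct `e` and `f` outside `A`, this is the exchange relation for the minor on these
    -- two elements. If one of them lies in `A`, its factor is trivial in either position.
    factor-swap : ∀ A e f → factor E P A e ∙ factor E P (A ∪ ⁅ e ⁆) f ∼
                            factor E P A f ∙ factor E P (A ∪ ⁅ f ⁆) e
    factor-swap A e f with T? (A e) | T? (A f) | decEq E e f
    ... | yes e∈A | _ | _ = factor-swap-∈ A e f e∈A
    ... | no _ | yes f∈A | _ = ∼-sym (factor-swap-∈ A f e f∈A)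
    ... | no _ | no _ | yes ≡.refl = ∼-refl
    ... | no e∉A | no f∉A | no e≢f = ∼-trans (∼-sym (two-element-minor A D (λ _ → ≡.refl)))
      (∼-trans (exchange-atoms E (P // A ∥ D) Z-inj {x} {y} (e≢f ∘ cong (label (P // A ∥ D))) only)
        (two-element-minor A D (λ z → ∨-comm (⁅ e ⁆ z) (⁅ f ⁆ z))))
      where
      D : Subset E
      D = ⁅ e ⁆ ∪ ⁅ f ⁆

      Z-inj : LabelInjective (P // A ∥ D)
      Z-inj = ∥-injective (P // A) D (//-injective P A id)

      x y : El (ground (P // A ∥ D))
      x = (e , not-T e∉A) , T-∨ˡ (≡⇒∈⁅⁆ E ≡.refl)
      y = (f , not-T f∉A) , T-∨ʳ (⁅ e ⁆ f) (≡⇒∈⁅⁆ E ≡.refl)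

      only : ∀ z → z ≡ x ⊎ z ≡ y
      only z = T-∨-elim
        (λ z∈e → inj₁ (Z-inj (≡.sym (∈⁅⁆⇒≡ E z∈e))))
        (λ z∈f → inj₂ (Z-inj (≡.sym (∈⁅⁆⇒≡ E z∈f)))) (proj₂ z)

    -- Permutations are generated by swaps of neighbours, which `factor-swap` handles; after a swap
    -- the tail starts from the same set, since union is commutative.
    word-↭ : ∀ {A l m} → l ↭ m → word E P A l ∼ word E P A m
    word-↭ refl         = ∼-refl
    word-↭ (prep e l↭m) = ∙-cong ∼-refl (word-↭ l↭m)
    word-↭ {A} {e ∷ f ∷ l} {f ∷ e ∷ m} (swap e f l↭m) = begin
      factor E P A e ∙ (factor E P (A ∪ ⁅ e ⁆) f ∙ word E P ((A ∪ ⁅ e ⁆) ∪ ⁅ f ⁆) l)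
        ≈⟨ V.∙-assoc _ _ _ ⟨
      (factor E P A e ∙ factor E P (A ∪ ⁅ e ⁆) f) ∙ word E P ((A ∪ ⁅ e ⁆) ∪ ⁅ f ⁆) l
        ≈⟨ ∙-cong (factor-swap A e f) (∼-trans (word-↭ l↭m) (word-cong E P commute m)) ⟩
      (factor E P A f ∙ factor E P (A ∪ ⁅ f ⁆) e) ∙ word E P ((A ∪ ⁅ f ⁆) ∪ ⁅ e ⁆) m
        ≈⟨ V.∙-assoc _ _ _ ⟩
      factor E P A f ∙ (factor E P (A ∪ ⁅ f ⁆) e ∙ word E P ((A ∪ ⁅ f ⁆) ∪ ⁅ e ⁆) m) ∎
      where
      open SetoidReasoning V.setoid
      commute : (A ∪ ⁅ e ⁆) ∪ ⁅ f ⁆ ≗ (A ∪ ⁅ f ⁆) ∪ ⁅ e ⁆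
      commute x = ≡.trans (∨-assoc (A x) _ _)
        (≡.trans (cong (A x ∨_) (∨-comm (⁅ e ⁆ x) _)) (≡.sym (∨-assoc (A x) _ _)))
    word-↭ (trans l↭m m↭n) = ∼-trans (word-↭ l↭m) (word-↭ m↭n)

    -- Since factors of repeated elements vanish, both sides equal the word of
    -- l ++ m, up to a permutation of that list.

    word-unique : ∀ A {l m} → (∀ e → e ∈ l) → (∀ e → e ∈ m) → word E P A l ∼ word E P A m
    word-unique A {l} {m} l-full m-full = begin
      word E P A l         ≈⟨ append l-full ⟩
      word E P A (l ++ m)  ≈⟨ word-↭ (++-comm l m) ⟩
      word E P A (m ++ l)  ≈⟨ append m-full ⟨
      word E P A m         ∎
      where
      open SetoidReasoning V.setoid
      append : ∀ {l m} → (∀ e → e ∈ l) → word E P A l ∼ word E P A (l ++ m)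
      append {l} {m} l-full = begin
        word E P A l
          ≈⟨ V.identityʳ _ ⟨
        word E P A l ∙ ε
          ≈⟨ ∙-cong ∼-refl (word-full E P (∈⇒∈adjoin E ∘ l-full) m) ⟨
        word E P A l ∙ word E P (adjoin E A l) m
          ≈⟨ word-++ E P A l m ⟨
        word E P A (l ++ m) ∎

  -- The factorisation of a structure, and its behaviour under minors.

  factorise : ∀ {E} → Str E → Word (Str ⟨ 1 ⟩)
  factorise {E} X = word E ⟪ X ⟫ (none E) (elements E)

  -- Transporting the ordering of `E` along `σ` gives another list covering `F`, to which
  -- `word-unique` applies.
  factorise-relabel : ∀ {E F} (σ : El E ↔ El F) {X : Str E} {Y : Str F} → relabel {E} {F} σ X ≈ Y →
                      factorise X ∼ factorise Y
  factorise-relabel {E} {F} σ {X} {Y} σX≈Y = ∼-trans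
    (word-Iso E F {to σ} {⟪ X ⟫} {⟪ Y ⟫} (along σ (λ _ → ≡.refl) σX≈Y) (to-injective σ)
      {none E} {none F} (λ _ → ≡.refl) (elements E))
    (word-unique Y (none F) covers (∈-elements F))
    where
    covers : ∀ f → f ∈ map (to σ) (elements E)
    covers f = subst (_∈ map (to σ) (elements E)) (strictlyInverseˡ σ f)
      (∈-map⁺ (to σ) (∈-elements E (from σ f)))

  factorise-minors : ∀ {E} (X : Str E) A → factorise X ∼ factorise (X ∣ A) ∙ factorise (X / A)
  factorise-minors {E} X A = begin
    word E ⟪ X ⟫ (none E) (elements E)
      ≈⟨ word-unique X (none E) (∈-elements E) covers ⟩
    word E ⟪ X ⟫ (none E) (l ++ m)
      ≈⟨ word-++ E ⟪ X ⟫ (none E) l m ⟩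
    word E ⟪ X ⟫ (none E) l ∙ word E ⟪ X ⟫ (adjoin E (none E) l) m
      ≈⟨ ∙-cong (∼-sym restriction) (∼-sym contraction) ⟩
    factorise (X ∣ A) ∙ factorise (X / A) ∎
    where
    open SetoidReasoning V.setoid

    l m : List (El E)
    l = map proj₁ (elements (sub E A))
    m = map proj₁ (elements (sub E (∁ A)))

    covers : ∀ e → e ∈ l ++ m
    covers e with T? (A e)
    ... | yes e∈A = ∈-++⁺ˡ (∈-map⁺ proj₁ (∈-elements (sub E A) (e , e∈A)))
    ... | no e∉A  = ∈-++⁺ʳ l (∈-map⁺ proj₁ (∈-elements (sub E (∁ A)) (e , not-T e∉A)))

    restriction : factorise (X ∣ A) ∼ word E ⟪ X ⟫ (none E) l
    restriction = ∼-trans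
      (word-Iso (sub E A) E (⟪⟫-∣ X A) (subset≡ A) {none (sub E A)} {none E}
        (λ _ → ≡.refl) (elements (sub E A)))
      (word-∥ E ⟪ X ⟫ {none E} {A} (λ _ ()) (elements (sub E A)))

    contraction : factorise (X / A) ∼ word E ⟪ X ⟫ (adjoin E (none E) l) m
    contraction = ∼-trans
      (word-Iso (sub E (∁ A)) E (⟪⟫-/ X A) (subset≡ (∁ A)) {none (sub E (∁ A))} {none E}
        (λ _ → ≡.refl) (elements (sub E (∁ A))))
      -- Contracting `A` first turns the empty starting set into `A`, the set adjoined by the list
      -- `l`.
      (∼-trans (word-// E ⟪ X ⟫ (none E) A m)
        (word-cong E ⟪ X ⟫ (λ e → ≡.trans (∨-identityʳ (A e)) (≡.sym (adjoin-elements E A e))) m))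

  -- Direct sums with structures on the empty set.

  infixl 7 _⊞_
  _⊞_ : ∀ {L} → Over L → Str ∅ → Over L
  (P ⊞ Y) .ground    = ground P
  (P ⊞ Y) .label     = label P
  (P ⊞ Y) .structure = structure P ⊕ Y

  ⊞-cong : ∀ {L} {P Q : Over L} (Y : Str ∅) → P ≃ Q → P ⊞ Y ≃ Q ⊞ Y
  ⊞-cong {P = P} {Q} Y (along σ labels p) = along σ labels
    (≈-trans (⊕-relabel {ground P} {ground Q} σ (structure P) Y)
      (⊕-cong {ground Q} p (≈-refl {∅})))

  ⊞-∥ : ∀ {L} (P : Over L) (Y : Str ∅) A → (P ⊞ Y) ∥ A ≃ (P ∥ A) ⊞ Y
  ⊞-∥ P Y A = ≃-trans (≃-sym (restrict-≃ (P ⊞ Y) _ (λ _ → ≡.refl)))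
    (≃-trans {Q = restrict₀ (ground P) (label P) (structure P) (A ∘ label P) ⊞ Y}
      (along (↔-id _) (λ _ → ≡.refl)
        (≈-trans (relabel-id ((structure P ⊕ Y) ∣ (A ∘ label P)))
          (⊕-∣ {ground P} (structure P) Y (A ∘ label P))))
      (⊞-cong Y (restrict-≃ P _ (λ _ → ≡.refl))))

  ⊞-// : ∀ {L} (P : Over L) (Y : Str ∅) A → (P ⊞ Y) // A ≃ (P // A) ⊞ Y
  ⊞-// P Y A = ≃-trans (≃-sym (contract-≃ (P ⊞ Y) _ (λ _ → ≡.refl)))
    (≃-trans {Q = contract₀ (ground P) (label P) (structure P) (A ∘ label P) ⊞ Y}
      (along (↔-id _) (λ _ → ≡.refl)
        (≈-trans (relabel-id ((structure P ⊕ Y) / (A ∘ label P)))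
          (⊕-/ {ground P} (structure P) Y (A ∘ label P))))
      (⊞-cong Y (contract-≃ P _ (λ _ → ≡.refl))))

  opaque
    unfolding atom

    -- On one element this is relation (2); for every other size both sides are `ε`.
    atom-⊞ : ∀ {L} (P : Over L) (Y : Str ∅) → atom (P ⊞ Y) ∼ atom P
    atom-⊞ P Y = helper (size (ground P)) (enum (ground P))
      where
      helper : ∀ n σ → atomOn n (ground P) σ (structure P ⊕ Y) ∼ atomOn n (ground P) σ (structure P)
      helper 0             σ = ∼-refl
      helper 1             σ = ∼-trans
        (V.gen-cong (↔-id _ , ≈-trans (relabel-id _) (⊕-relabel {ground P} {⟨ 1 ⟩} σ (structure P) Y)))
        (V.relation (sum (class σ (structure P)) Y))
      helper (suc (suc _)) σ = ∼-refl

    atom-one : (X : Str ⟨ 1 ⟩) → atom ⟪ X ⟫ ∼ gen X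
    atom-one X = V.gen-cong (Setoid.sym (S 1) (↔-id _ , ≈-refl))

  word-⊞ : ∀ E (P : Over (El E)) (Y : Str ∅) A l → word E (P ⊞ Y) A l ∼ word E P A l
  word-⊞ E P Y A []      = ∼-refl
  word-⊞ E P Y A (e ∷ l) = ∙-cong
    (∼-trans
      (atom-Iso (≃-trans
        (∥-cong (⊞-// P Y A) {⁅ E ∋ e ⁆} {⁅ E ∋ e ⁆} (λ _ → ≡.refl)) (⊞-∥ (P // A) Y ⁅ E ∋ e ⁆)))
      (atom-⊞ (P // A ∥ ⁅ E ∋ e ⁆) Y))
    (word-⊞ E P Y (A ∪ ⁅ E ∋ e ⁆) l)

  factorise-⊕ : ∀ {E} (X : Str E) (Y : Str ∅) → factorise (X ⊕ Y) ∼ factorise X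
  factorise-⊕ {E} X Y = ∼-trans
    (word-Iso E E {id} {⟪ X ⊕ Y ⟫} {⟪ X ⟫ ⊞ Y} (along (↔-id _) (λ _ → ≡.refl) (relabel-id _)) id
      {none E} {none E} (λ _ → ≡.refl) (elements E))
    (∼-trans (word-⊞ E ⟪ X ⟫ Y (none E) (map id (elements E)))
      -- Removes the `map id` introduced by `word-Iso`.
      (word-unique X (none E) (λ e → ∈-map⁺ id (∈-elements E e)) (∈-elements E)))

  -- The list of elements computes to a single entry, and the only factor, the contraction of
  -- nothing restricted to everything, is `X` itself.
  factorise-one : (X : Str ⟨ 1 ⟩) → factorise X ∼ gen X
  factorise-one X = ∼-trans (V.identityʳ _) (∼-trans (atom-Iso whole) (atom-one X))
    where
    whole : ⟪ X ⟫ // none ⟨ 1 ⟩ ∥ ⁅ ⟨ 1 ⟩ ∋ zero ⁆ ≃ ⟪ X ⟫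
    whole = ≃-trans (∥-full (⟪ X ⟫ // none ⟨ 1 ⟩) {⁅ ⟨ 1 ⟩ ∋ zero ⁆} (λ { (zero , _) → tt }))
      (//-none ⟪ X ⟫ {none ⟨ 1 ⟩} (λ _ ()))

  factorise-class : ∀ {E} (X : Str E) → factorise (proj₂ (class• X)) ∼ factorise X
  factorise-class {E} X = ∼-sym (factorise-relabel {E} {⟨ size E ⟩} (enum E) ≈-refl)

  -- The inverse morphism on the Grothendieck monoid.

  module W where
    open Presentation S• (GrothendieckRelation 𝐒) public
    open CommutativeMonoid (U 𝐒) public using (identityʳ; setoid)

  infix 4 _∼ᵁ_
  _∼ᵁ_ = W._∼_

  inverse : Word (Setoid.Carrier S•) → Word (Str ⟨ 1 ⟩)
  inverse = extend (OneElementMonoid 𝐒) (λ (_ , X) → factorise X)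

  inverse-cong : ∀ {u v} → u ∼ᵁ v → inverse u ∼ inverse v
  inverse-cong W.∼-refl                = ∼-refl
  inverse-cong (W.∼-sym u∼v)           = ∼-sym (inverse-cong u∼v)
  inverse-cong (W.∼-trans u∼v v∼w)     = ∼-trans (inverse-cong u∼v) (inverse-cong v∼w)
  inverse-cong (W.∙-cong u∼u′ v∼v′)    = ∙-cong (inverse-cong u∼u′) (inverse-cong v∼v′)
  inverse-cong (W.∙-assoc u v w)       = V.∙-assoc _ _ _
  inverse-cong (W.∙-identityˡ u)       = V.∙-identityˡ _
  inverse-cong (W.∙-comm u v)          = V.∙-comm _ _
  inverse-cong (W.gen-cong (iso {n} (σ , σX≈Y))) = factorise-relabel {⟨ n ⟩} {⟨ n ⟩} σ σX≈Y
  inverse-cong (W.relation (minors X A)) = ∼-trans (factorise-class X)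
    (∼-trans (factorise-minors X A)
      (∙-cong (∼-sym (factorise-class (X ∣ A))) (∼-sym (factorise-class (X / A)))))
  inverse-cong (W.relation (sum X Y)) = ∼-trans (factorise-class (X ⊕ Y))
    (∼-trans (factorise-⊕ X Y) (∼-sym (factorise-class X)))
  -- The empty set is listed by the empty list, so the factorisation of `𝟙` computes to `ε`.
  inverse-cong (W.relation unit) = ∼-refl

  inverse-natural : ∀ u → inverse (natural 𝐒 u) ∼ u
  inverse-natural (gen X) = factorise-one X
  inverse-natural ε       = ∼-refl
  inverse-natural (u ∙ v) = ∙-cong (inverse-natural u) (inverse-natural v)

  -- Telescoping in the Grothendieck monoid.

  gen-Iso : ∀ {L M} {f : L → M} {P Q} {m n} → Iso f P Q →
            (σ : El (ground P) ↔ Fin m) (τ : El (ground Q) ↔ Fin n) →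
            gen (m , class σ (structure P)) ∼ᵁ gen (n , class τ (structure Q))
  gen-Iso p σ τ with size-Iso p σ τ
  ... | ≡.refl = W.gen-cong (iso (class-Iso p σ τ))

  -- `Y` is the sum of `𝟙` and `Y`, and dropping the summand `Y` leaves the class of `𝟙`, which is
  -- trivial.
  gen-∅ : (Y : Str ∅) → gen (0 , Y) ∼ᵁ ε
  gen-∅ Y = begin
    gen (0 , Y)           ≈⟨ W.gen-cong (iso (↔-id _ , ≈-trans (relabel-id Y) (≈-sym unital))) ⟩
    gen (0 , 𝟙 ⊕ Y)       ≈⟨ by-class (𝟙 ⊕ Y) ⟩
    gen (class• (𝟙 ⊕ Y))  ≈⟨ W.relation (sum 𝟙 Y) ⟩
    gen (class• 𝟙)        ≈⟨ W.relation unit ⟩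
    ε                     ∎
    where
    open SetoidReasoning W.setoid
    unital : 𝟙 ⊕ Y ≈ Y
    unital = ≈-trans (⊕-comm 𝟙 Y) (⊕-identityʳ {∅} Y)
    by-class : ∀ Y → gen (0 , Y) ∼ᵁ gen (class• {∅} Y)
    by-class Y = W.gen-cong (iso (↔-id _ , ≈-refl))

  opaque
    ⟦_⟧ : ∀ {L} → Over L → Word (Setoid.Carrier S•)
    ⟦ P ⟧ = gen (class• (structure P))

    gen∼⟦⟧ : ∀ {L M} {f : L → M} {P Q} {n} → Iso f P Q → (σ : El (ground P) ↔ Fin n) →
             gen (n , class σ (structure P)) ∼ᵁ ⟦ Q ⟧
    gen∼⟦⟧ {Q = Q} p σ = gen-Iso p σ (enum (ground Q))

    ⟦⟧-Iso : ∀ {L M} {f : L → M} {P Q} → Iso f P Q → ⟦ P ⟧ ∼ᵁ ⟦ Q ⟧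
    ⟦⟧-Iso {P = P} p = gen∼⟦⟧ p (enum (ground P))

    ⟦⟧-class• : ∀ {E} (X : Str E) → ⟦ ⟪ X ⟫ ⟧ ∼ᵁ gen (class• X)
    ⟦⟧-class• X = W.∼-refl

    ⟦⟧-minors : ∀ {L} (P : Over L) A → ⟦ P ⟧ ∼ᵁ ⟦ P ∥ A ⟧ ∙ ⟦ P // A ⟧
    ⟦⟧-minors P A = W.∼-trans (W.relation (minors {E = ground P} (structure P) A′))
      (W.∙-cong
        (gen∼⟦⟧ {P = restrict₀ (ground P) (label P) (structure P) A′} {Q = P ∥ A}
          (restrict-≃ P A′ (λ _ → ≡.refl)) (enum (sub (ground P) A′)))
        (gen∼⟦⟧ {P = contract₀ (ground P) (label P) (structure P) A′} {Q = P // A}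
          (contract-≃ P A′ (λ _ → ≡.refl)) (enum (sub (ground P) (∁ A′)))))
      where
      A′ : Subset (ground P)
      A′ = A ∘ label P

    ⟦⟧-empty : ∀ {L} (P : Over L) → (El (ground P) → ⊥) → ⟦ P ⟧ ∼ᵁ ε
    ⟦⟧-empty P empty = helper (size (ground P)) (enum (ground P))
      where
      helper : ∀ n σ → gen (n , class {ground P} {n} σ (structure P)) ∼ᵁ ε
      helper 0       σ = gen-∅ _
      helper (suc _) σ = ⊥-elim (empty (from σ zero))

  opaque
    unfolding atom ⟦_⟧

    -- On an empty ground set the value `ε` of `atom` is correct by `gen-∅`; the junk value for two
    -- or more elements is excluded by hypothesis.
    natural-atom : ∀ {L} (P : Over L) → (∀ (x y : El (ground P)) → x ≡ y) →
                   natural 𝐒 (atom P) ∼ᵁ ⟦ P ⟧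
    natural-atom P prop = helper (size (ground P)) (enum (ground P))
      where
      helper : ∀ n σ → natural 𝐒 (atomOn n (ground P) σ (structure P)) ∼ᵁ
                       gen (n , class {ground P} {n} σ (structure P))
      helper 0             σ = W.∼-sym (gen-∅ _)
      helper 1             σ = W.∼-refl
      helper (suc (suc _)) σ
        with () ← to-injective (↔-sym σ) (prop (from σ zero) (from σ (suc zero)))

  -- The part of `X` not yet contracted is kept as a last factor, so that induction runs over
  -- arbitrary lists.
  natural-word : ∀ {E} (X : Str E) A l →
    ⟦ ⟪ X ⟫ // A ⟧ ∼ᵁ natural 𝐒 (word E ⟪ X ⟫ A l) ∙ ⟦ ⟪ X ⟫ // adjoin E A l ⟧
  natural-word X A []      = W.∼-sym (W.∙-identityˡ _)
  natural-word {E} X A (e ∷ l) = begin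
    ⟦ P // A ⟧
      ≈⟨ ⟦⟧-minors (P // A) ⁅ E ∋ e ⁆ ⟩
    ⟦ P // A ∥ ⁅ E ∋ e ⁆ ⟧ ∙ ⟦ P // A // ⁅ E ∋ e ⁆ ⟧
      ≈⟨ W.∙-cong (W.∼-sym (natural-atom (P // A ∥ ⁅ E ∋ e ⁆) prop))
           (W.∼-trans (⟦⟧-Iso (//-// P A ⁅ E ∋ e ⁆)) (natural-word X (A ∪ ⁅ E ∋ e ⁆) l)) ⟩
    natural 𝐒 (factor E P A e) ∙
      (natural 𝐒 (word E P (A ∪ ⁅ E ∋ e ⁆) l) ∙ ⟦ P // adjoin E A (e ∷ l) ⟧)
      ≈⟨ W.∙-assoc _ _ _ ⟨
    natural 𝐒 (word E P A (e ∷ l)) ∙ ⟦ P // adjoin E A (e ∷ l) ⟧ ∎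
    where
    open SetoidReasoning W.setoid
    P = ⟪ X ⟫
    prop : ∀ (x y : El (ground (P // A ∥ ⁅ E ∋ e ⁆))) → x ≡ y
    prop x y = ∥-injective (P // A) ⁅ E ∋ e ⁆ (//-injective P A id)
      (≡.trans (≡.sym (∈⁅⁆⇒≡ E (proj₂ x))) (∈⁅⁆⇒≡ E (proj₂ y)))

  natural-factorise : ∀ {E} (X : Str E) → natural 𝐒 (factorise X) ∼ᵁ gen (class• X)
  natural-factorise {E} X = begin
    natural 𝐒 (factorise X)                         ≈⟨ W.identityʳ _ ⟨
    natural 𝐒 (factorise X) ∙ ε                     ≈⟨ W.∙-cong W.∼-refl (⟦⟧-empty rest exhausted) ⟨
    natural 𝐒 (factorise X) ∙ ⟦ rest ⟧              ≈⟨ natural-word X (none E) (elements E) ⟨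
    ⟦ ⟪ X ⟫ // none E ⟧                             ≈⟨ ⟦⟧-Iso (//-none ⟪ X ⟫ {none E} (λ _ ())) ⟩
    ⟦ ⟪ X ⟫ ⟧                                       ≈⟨ ⟦⟧-class• X ⟩
    gen (class• X)                                  ∎
    where
    open SetoidReasoning W.setoid
    rest : Over (El E)
    rest = ⟪ X ⟫ // adjoin E (none E) (elements E)
    exhausted : El (ground rest) → ⊥
    exhausted (e , e∉) = T-not (∈⇒∈adjoin E {none E} (∈-elements E e)) e∉

  -- The natural morphism: well-definedness and bijectivity.

  gen-class• : ∀ {n} (X : Str ⟨ n ⟩) → gen (n , X) ∼ᵁ gen (class• X)
  gen-class• X = W.gen-cong (iso (↔-id _ , ≈-refl))

  natural-inverse : ∀ w → natural 𝐒 (inverse w) ∼ᵁ w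
  natural-inverse (gen (n , X)) = W.∼-trans (natural-factorise X) (W.∼-sym (gen-class• X))
  natural-inverse ε       = W.∼-refl
  natural-inverse (u ∙ v) = W.∙-cong (natural-inverse u) (natural-inverse v)

  -- Applied to the singletons of `e` and of `f`, this sends both sides of an exchange relation to
  -- the class of `X`.
  natural-pair : ∀ {E} (X : Str E) (A : Subset E)
    (σ : El (sub E A) ↔ Fin 1) (τ : El (sub E (∁ A)) ↔ Fin 1) →
    gen (1 , class σ (X ∣ A)) ∙ gen (1 , class τ (X / A)) ∼ᵁ gen (class• X)
  natural-pair {E} X A σ τ = W.∼-trans
    (W.∙-cong (gen-Iso (≃-refl {P = restrict₀ E id X A}) σ (enum (sub E A)))
              (gen-Iso (≃-refl {P = contract₀ E id X A}) τ (enum (sub E (∁ A)))))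
    (W.∼-sym (W.relation (minors X A)))

  natural-cong : ∀ {u v} → u ∼ v → natural 𝐒 u ∼ᵁ natural 𝐒 v
  natural-cong V.∼-refl             = W.∼-refl
  natural-cong (V.∼-sym u∼v)        = W.∼-sym (natural-cong u∼v)
  natural-cong (V.∼-trans u∼v v∼w)  = W.∼-trans (natural-cong u∼v) (natural-cong v∼w)
  natural-cong (V.∙-cong u∼u′ v∼v′) = W.∙-cong (natural-cong u∼u′) (natural-cong v∼v′)
  natural-cong (V.∙-assoc u v w)    = W.∙-assoc _ _ _
  natural-cong (V.∙-identityˡ u)    = W.∙-identityˡ _
  natural-cong (V.∙-comm u v)       = W.∙-comm _ _
  natural-cong (V.gen-cong X≅Y)     = W.gen-cong (iso X≅Y)
  natural-cong (V.relation (exchange {E} e f e≢f E≡ef X)) = W.∼-trans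
    (natural-pair X ⁅ E ∋ e ⁆ _ _) (W.∼-sym (natural-pair X ⁅ E ∋ f ⁆ _ _))
  natural-cong (V.relation (sum X Y)) = W.∼-trans (gen-class• (X ⊕ Y))
    (W.∼-trans (W.relation (sum X Y)) (W.∼-sym (gen-class• X)))

  natural-isMonoidIsomorphism : IsMonoidIsomorphism
    (CommutativeMonoid.rawMonoid (OneElementMonoid 𝐒)) (CommutativeMonoid.rawMonoid (U 𝐒)) (natural 𝐒)
  natural-isMonoidIsomorphism = record
    { isMonoidMonomorphism = record
      { isMonoidHomomorphism = record
        { isMagmaHomomorphism = record
          { isRelHomomorphism = record { cong = natural-cong }
          ; homo = λ _ _ → W.∼-refl
          }
        ; ε-homo = W.∼-refl
        }
      ; injective = λ {u} {v} u∼v → ∼-trans (∼-sym (inverse-natural u))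
          (∼-trans (inverse-cong u∼v) (inverse-natural v))
      }
    ; surjective = λ w → inverse w ,
        λ u∼w → W.∼-trans (natural-cong u∼w) (natural-inverse w)
    }

theorem3p10 : ∀ {c ℓ} (𝐒 : MinorsSystem c ℓ) →
    IsMonoidIsomorphism (CommutativeMonoid.rawMonoid (OneElementMonoid 𝐒)) (CommutativeMonoid.rawMonoid (U 𝐒)) (natural 𝐒)
theorem3p10 = natural-isMonoidIsomorphism
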